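{- Let $P$ be an interval order with no infinite antichains such that the incomparability graph $\mathrm{Inc}(P)$ is connected and has infinite diameter. Then $\mathrm{Inc}(P)$ has an infinite isometric path.
   Context: A poset $P$ is an interval order if it is isomorphic to a set of non-empty intervals of some chain $C$, ordered by: $I<J$ iff $x<y$ for every $x\in I$ and every $y\in J$. The incomparability graph $\mathrm{Inc}(P)$ of $P=(V,\le)$ has vertex set $V$ and edges the pairs of incomparable elements. For a graph $G$, $d_G(x,y)$ is the length of a shortest path joining $x$ and $y$ ($\infty$ if none); the diameter of $G$ is $\sup\{d_G(x,y):x,y\in V(G)\}$. An infinite isometric path of $G$ is a sequence $(x_n)_{n\in\mathbb N}$ of vertices with $d_G(x_i,x_j)=|i-j|$ for all $i,j\in\mathbb N$. -}

module Defs where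

open import Data.List.Base using (List; []; _∷_)
import Data.List.Membership.Setoid as Membership
import Data.List.Relation.Unary.Unique.Setoid as Unique
open import Data.Nat.Base as ℕ using (ℕ; zero; suc; ∣_-_∣)
open import Data.Product.Base using (Σ-syntax; ∃; ∃₂; ∃-syntax; _×_; _,_; proj₁)
open import Data.Sum.Base using (_⊎_)
open import Level using (Level; _⊔_) renaming (suc to lsuc)
open import Relation.Binary.Bundles using (Poset; Setoid; TotalOrder)
open import Relation.Binary.Construct.Add.Supremum.NonStrict ℕ._≤_ using (_≤⁺_)
import Relation.Binary.Construct.NonStrictToStrict as ToStrict
open import Relation.Binary.Core using (Rel)
open import Relation.Binary.Definitions using (Symmetric; Irreflexive; _Respects₂_)
open import Relation.Binary.Morphism.Structures using (IsOrderIsomorphism)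
open import Relation.Nullary.Construct.Add.Supremum using (_⁺; [_]; ⊤⁺)
open import Relation.Nullary.Negation.Core using (¬_)
open import Relation.Unary using (Pred; _∈_; _⊆_; _≐_; Satisfiable)

private
  variable
    c ℓ ℓ₁ ℓ₂ : Level

------------------------------------------------------------------------
-- Interval orders

module _ {r : Level} (C : TotalOrder r r r) where
  open TotalOrder C
  open ToStrict _≈_ _≤_ using (_<_)

  -- Convexity already forces members to be closed under _≈_.
  record Interval : Set (lsuc r) where
    field
      member   : Pred Carrier r
      convex   : ∀ {x y z} → x ∈ member → y ∈ member → x ≤ z → z ≤ y → z ∈ member
      nonempty : Satisfiable member

  open Interval

  _≈ᴵ_ : Rel Interval r
  I ≈ᴵ J = member I ≐ member J

  _<ᴵ_ : Rel Interval r
  I <ᴵ J = ∀ {x y} → x ∈ member I → y ∈ member J → x < y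

  _≤ᴵ_ : Rel Interval r
  I ≤ᴵ J = I <ᴵ J ⊎ I ≈ᴵ J

-- One level r, unrelated to the levels of P, covers every chain and
-- every set of intervals, since these can be lifted to a common level.
IsIntervalOrder : (r : Level) → Poset c ℓ₁ ℓ₂ → Set (c ⊔ ℓ₁ ⊔ ℓ₂ ⊔ lsuc (lsuc r))
IsIntervalOrder r P =
  Σ[ C ∈ TotalOrder r r r ]
  Σ[ S ∈ Pred (Interval C) (lsuc r) ]
  Σ[ f ∈ (Carrier → ∃ S) ]
    IsOrderIsomorphism
      _≈_ (λ I J → _≈ᴵ_ C (proj₁ I) (proj₁ J))
      _≤_ (λ I J → _≤ᴵ_ C (proj₁ I) (proj₁ J))
      f
  where open Poset P

------------------------------------------------------------------------
-- Antichains

module _ (P : Poset c ℓ₁ ℓ₂) where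
  open Poset P

  Incomparable : Rel Carrier ℓ₂
  Incomparable x y = ¬ (x ≤ y) × ¬ (y ≤ x)

  IsAntichain : Pred Carrier ℓ → Set (c ⊔ ℓ₁ ⊔ ℓ₂ ⊔ ℓ)
  IsAntichain A = ∀ {x y} → x ∈ A → y ∈ A → ¬ (x ≈ y) → Incomparable x y

  -- The list may contain elements outside A, and is taken up to _≈_.
  IsFinite : Pred Carrier ℓ → Set (c ⊔ ℓ₁ ⊔ ℓ)
  IsFinite A = Σ[ xs ∈ List Carrier ] A ⊆ (λ x → Membership._∈_ Eq.setoid x xs)

  NoInfiniteAntichain : Set (lsuc (c ⊔ ℓ₁ ⊔ ℓ₂))
  NoInfiniteAntichain =
    ¬ (Σ[ A ∈ Pred Carrier (c ⊔ ℓ₁ ⊔ ℓ₂) ] IsAntichain A × ¬ IsFinite A)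

------------------------------------------------------------------------
-- Graphs

record Graph c ℓ₁ ℓ₂ : Set (lsuc (c ⊔ ℓ₁ ⊔ ℓ₂)) where
  field
    vertices : Setoid c ℓ₁

  open Setoid vertices public renaming (Carrier to V) using (_≈_)

  field
    _~_      : Rel V ℓ₂
    ~-sym    : Symmetric _~_
    ~-irrefl : Irreflexive _≈_ _~_
    ~-resp-≈ : _~_ Respects₂ _≈_

Inc : Poset c ℓ₁ ℓ₂ → Graph c ℓ₁ ℓ₂
Inc P = record
  { vertices = Eq.setoid
  ; _~_      = Incomparable P
  ; ~-sym    = λ (x≰y , y≰x) → y≰x , x≰y
  ; ~-irrefl = λ x≈y (x≰y , _) → x≰y (reflexive x≈y)
  ; ~-resp-≈ =
      (λ y≈y′ (x≰y , y≰x) → (λ x≤y′ → x≰y (≤-respʳ-≈ (Eq.sym y≈y′) x≤y′))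
                          , (λ y′≤x → y≰x (≤-respˡ-≈ (Eq.sym y≈y′) y′≤x)))
    , (λ x≈x′ (x≰y , y≰x) → (λ x′≤y → x≰y (≤-respˡ-≈ (Eq.sym x≈x′) x′≤y))
                          , (λ y≤x′ → y≰x (≤-respʳ-≈ (Eq.sym x≈x′) y≤x′)))
  }
  where open Poset P

module _ (G : Graph c ℓ₁ ℓ₂) where
  open Graph G

  data Walk : V → V → ℕ → Set (c ⊔ ℓ₁ ⊔ ℓ₂) where
    nil  : ∀ {x y} → x ≈ y → Walk x y zero
    cons : ∀ {x y z n} → x ~ y → Walk y z n → Walk x z (suc n)

  walkVertices : ∀ {x y n} → Walk x y n → List V
  walkVertices {x} (nil _)    = x ∷ []
  walkVertices {x} (cons _ w) = x ∷ walkVertices w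

  Path : V → V → ℕ → Set (c ⊔ ℓ₁ ⊔ ℓ₂)
  Path x y n = Σ[ w ∈ Walk x y n ] Unique.Unique vertices (walkVertices w)

  Connected : Set (c ⊔ ℓ₁ ⊔ ℓ₂)
  Connected = ∀ x y → ∃[ n ] Path x y n

  -- IsDistance x y d says d(x,y) = d, with ⊤⁺ playing the role of ∞.
  -- It is a relation because d(x,y) is not computable in general.
  IsDistance : V → V → ℕ ⁺ → Set (c ⊔ ℓ₁ ⊔ ℓ₂)
  IsDistance x y [ n ] = Path x y n × (∀ {m} → Path x y m → n ℕ.≤ m)
  IsDistance x y ⊤⁺    = ∀ {m} → ¬ Path x y m

IsSupremum : Pred (ℕ ⁺) ℓ → ℕ ⁺ → Set ℓ
IsSupremum D s = (∀ {d} → d ∈ D → d ≤⁺ s)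
               × (∀ {b} → (∀ {d} → d ∈ D → d ≤⁺ b) → s ≤⁺ b)

module _ (G : Graph c ℓ₁ ℓ₂) where
  open Graph G

  IsDiameter : ℕ ⁺ → Set (c ⊔ ℓ₁ ⊔ ℓ₂)
  IsDiameter = IsSupremum (λ d → ∃₂ λ x y → IsDistance G x y d)

  HasInfiniteDiameter : Set (c ⊔ ℓ₁ ⊔ ℓ₂)
  HasInfiniteDiameter = IsDiameter ⊤⁺

  IsInfiniteIsometricPath : (ℕ → V) → Set (c ⊔ ℓ₁ ⊔ ℓ₂)
  IsInfiniteIsometricPath p = ∀ i j → IsDistance G (p i) (p j) [ ∣ i - j ∣ ]

  HasInfiniteIsometricPath : Set (c ⊔ ℓ₁ ⊔ ℓ₂)
  HasInfiniteIsometricPath = ∃ IsInfiniteIsometricPath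

-- Fix a vertex o and let d be the distance to o in the incomparability graph.
-- Up to reversing the order, there are vertices not below o at every distance
-- n from o; call these level n.  If z < u and z is not below o, then every walk
-- from u to o meets z or a neighbour of z, so that d z ≤ d u; hence level n lies
-- below level n + 2.  If now y₁ < y₂ are in level n, y₁ has a neighbour z in
-- level n + 1 and y₂ a neighbour u in level n - 1, then y₁ < y₂ and u < z span a
-- 2 + 2.  So the members of level n with a neighbour in level n + 1 form an
-- antichain, which is finite and thus has a member whose strict up-set is least.
-- That member is adjacent to the whole of level n + 1, and these members, one
-- for each n, form the isometric path.
module Submission where

open import Axiom.ExcludedMiddle using (ExcludedMiddle)
open import Data.List.Base using (List; []; _∷_)
import Data.List.Membership.Setoid as Membership
open import Data.List.Relation.Unary.All as All using (All; []; _∷_)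
open import Data.List.Relation.Unary.AllPairs using ([]; _∷_)
open import Data.List.Relation.Unary.Any using (here; there)
import Data.List.Relation.Unary.Unique.Setoid as Unique
open import Data.Nat.Base as ℕ using (ℕ; zero; suc; _+_; _≤_; z≤n; s≤s; s≤s⁻¹; ∣_-_∣)
open import Data.Nat.Properties
  using ( +-comm; ∣m-n∣≡[m∸n]∨[n∸m]; m≤n+o⇒m∸n≤o; ∣-∣-identityʳ; ≤-refl; ≤-trans; ≤-antisym
        ; ≤-total; m≤n⇒m≤1+n; n≤1+n; n<1+n; 1+n≰n; n≤0⇒n≡0; ≤⇒≤′; ≮⇒≥; <⇒≢
        ; +-mono-≤; m+n≤o⇒m≤o; m+n≤o⇒n≤o)
open import Data.Product.Base using (Σ-syntax; ∃; ∃₂; ∃-syntax; _×_; _,_; proj₁; proj₂)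
open import Data.Sum.Base using (_⊎_; inj₁; inj₂; swap; fromInj₂)
open import Function.Base using (_∘_; flip; case_of_)
open import Level using (Level; _⊔_; Lift; lift; lower)
open import Relation.Binary.Bundles using (Poset; Setoid; TotalOrder; TotalPreorder)
open import Relation.Binary.Construct.Add.Supremum.NonStrict ℕ._≤_ using (_≤⁺_; [_])
import Relation.Binary.Construct.Flip.EqAndOrd as Flip
import Relation.Binary.Construct.NonStrictToStrict as ToStrict
open import Relation.Binary.Core using (Rel)
open import Relation.Binary.Definitions using (Decidable)
open import Relation.Binary.Morphism.Structures using (module IsOrderIsomorphism)
open import Relation.Binary.PropositionalEquality as ≡ using (_≡_; refl; subst)
import Relation.Binary.Properties.Poset as PosetProperties
open import Relation.Binary.Structures using (IsDecStrictPartialOrder)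
open import Relation.Nullary.Construct.Add.Supremum using ([_]; ⊤⁺)
open import Relation.Nullary.Decidable using (yes; no; map′; decidable-stable)
open import Relation.Nullary.Negation using (¬_; contradiction)
open import Relation.Unary using (Pred; _∈_; _⊆_)
open import Defs

private
  variable
    c ℓ ℓ₁ ℓ₂ ℓ₃ r : Level

-- Classical logic and natural numbers

lowerEM : ∀ a b → ExcludedMiddle (a ⊔ b) → ExcludedMiddle a
lowerEM a b em {A} = map′ lower lift (em {Lift b A})

least : {Q : Pred ℕ ℓ} → ExcludedMiddle ℓ → ∃ Q →
        ∃[ n ] n ∈ Q × (∀ {m} → m ∈ Q → n ≤ m)
least {Q = Q} em (n , Qn) = go n Qn
  where
  go : ∀ {Q : Pred ℕ _} n → n ∈ Q → ∃[ k ] k ∈ Q × (∀ {m} → m ∈ Q → k ≤ m)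
  go zero Qn = zero , Qn , λ _ → z≤n
  go {Q} (suc n) Qn with em {Q zero}
  ... | yes Q0 = zero , Q0 , λ _ → z≤n
  ... | no ¬Q0 = let k , Qk , k≤ = go {Q ∘ suc} n Qn in suc k , Qk , bound k≤
    where
    bound : ∀ {k m} → (∀ {m} → suc m ∈ Q → k ≤ m) → m ∈ Q → suc k ≤ m
    bound {m = zero}  k≤ Q0 = contradiction Q0 ¬Q0
    bound {m = suc m} k≤ Qm = s≤s (k≤ Qm)

∣m-n∣≤o : ∀ m n {o} → m ≤ o + n → n ≤ o + m → ∣ m - n ∣ ≤ o
∣m-n∣≤o m n {o} m≤o+n n≤o+m with ∣m-n∣≡[m∸n]∨[n∸m] m n
... | inj₁ eq rewrite eq = m≤n+o⇒m∸n≤o m n (subst (m ≤_) (+-comm o n) m≤o+n)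
... | inj₂ eq rewrite eq = m≤n+o⇒m∸n≤o n m (subst (n ≤_) (+-comm o m) n≤o+m)

-- Maxima over a finite list

module _ (T : TotalPreorder c ℓ₁ ℓ₂) where
  open TotalPreorder T
  open Membership Eq.setoid using () renaming (_∈_ to _∈ₗ_)

  -- `xs` may list elements outside `A`, so an entry counts only if it equals a member of `A`; the
  -- given member of `A` is the answer when no entry counts.
  greatest : {A : Pred Carrier ℓ} → ExcludedMiddle (c ⊔ ℓ₁ ⊔ ℓ) → ∃ A → ∀ xs →
             ∃[ y ] y ∈ A × (∀ {z} → z ∈ A → z ∈ₗ xs → z ≲ y)
  greatest em (y , Ay) [] = y , Ay , λ _ ()
  greatest {A = A} em inhabited (x ∷ xs)
    with greatest em inhabited xs | em {∃[ z ] z ∈ A × z ≈ x}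
  ... | y , Ay , ≲y | no ∄z = y , Ay , λ where
    Az (here z≈x)   → contradiction (_ , Az , z≈x) ∄z
    Az (there z∈xs) → ≲y Az z∈xs
  ... | y , Ay , ≲y | yes (w , Aw , w≈x) with total y w
  ...   | inj₁ y≲w = w , Aw , λ where
    Az (here z≈x)   → reflexive (Eq.trans z≈x (Eq.sym w≈x))
    Az (there z∈xs) → trans (≲y Az z∈xs) y≲w
  ...   | inj₂ w≲y = y , Ay , λ where
    Az (here z≈x)   → trans (reflexive (Eq.trans z≈x (Eq.sym w≈x))) w≲y
    Az (there z∈xs) → ≲y Az z∈xs

-- Walks and shortest walks

module _ {G : Graph c ℓ₁ ℓ₂} where
  open Graph G
  open Setoid vertices using () renaming (refl to ≈-refl; sym to ≈-sym; trans to ≈-trans)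

  walk-respˡ : ∀ {x y z n} → x ≈ y → Walk G x z n → Walk G y z n
  walk-respˡ x≈y (nil x≈z)    = nil (≈-trans (≈-sym x≈y) x≈z)
  walk-respˡ x≈y (cons x~u w) = cons (proj₂ ~-resp-≈ x≈y x~u) w

  _++_ : ∀ {x y z m n} → Walk G x y m → Walk G y z n → Walk G x z (m + n)
  nil x≈y  ++ w′ = walk-respˡ (≈-sym x≈y) w′
  cons e w ++ w′ = cons e (w ++ w′)

  snoc : ∀ {x y z n} → Walk G x y n → y ~ z → Walk G x z (suc n)
  snoc (nil x≈y)  y~z = cons (proj₂ ~-resp-≈ (≈-sym x≈y) y~z) (nil ≈-refl)
  snoc (cons e w) y~z = cons e (snoc w y~z)

  reverse : ∀ {x y n} → Walk G x y n → Walk G y x n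
  reverse (nil x≈y)  = nil (≈-sym x≈y)
  reverse (cons e w) = snoc (reverse w) (~-sym e)

  IsShortest : V → V → ℕ → Set _
  IsShortest x y n = ∀ {m} → Walk G x y m → n ≤ m

  suffixes : ∀ {x y n} (w : Walk G x y n) →
             All (λ v → ∃[ k ] k ≤ n × Walk G v y k) (walkVertices G w)
  suffixes (nil e)    = (zero , z≤n , nil e) ∷ []
  suffixes (cons e w) =
    (_ , ≤-refl , cons e w) ∷ All.map (λ (k , k≤n , w′) → k , m≤n⇒m≤1+n k≤n , w′) (suffixes w)

  -- If `x` recurred, the walk from the later occurrence would be shorter. Hence distances, defined
  -- by paths, can be computed with walks.
  shortest⇒unique : ∀ {x y n} (w : Walk G x y n) → IsShortest x y n →
                    Unique.Unique vertices (walkVertices G w)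
  shortest⇒unique (nil _)    _     = [] ∷ []
  shortest⇒unique (cons e w) short =
    All.map (λ (k , k≤n , w′) x≈v →
               1+n≰n (≤-trans (short (walk-respˡ (≈-sym x≈v) w′)) k≤n))
            (suffixes w)
    ∷ shortest⇒unique w (λ w′ → s≤s⁻¹ (short (cons e w′)))

  shortest⇒distance : ∀ {x y n} → Walk G x y n → IsShortest x y n → IsDistance G x y [ n ]
  shortest⇒distance w short = (w , shortest⇒unique w short) , short ∘ proj₁

  along : (p : ℕ → V) → (∀ n → p n ~ p (suc n)) → ∀ i j → Walk G (p i) (p j) ∣ i - j ∣
  along p e zero    zero    = nil ≈-refl
  along p e zero    (suc j) = cons (e 0) (along (p ∘ suc) (e ∘ suc) zero j)
  along p e (suc i) zero    =
    snoc (subst (Walk G _ _) (∣-∣-identityʳ i) (along (p ∘ suc) (e ∘ suc) i zero)) (~-sym (e 0))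
  along p e (suc i) (suc j) = along (p ∘ suc) (e ∘ suc) i j

-- Graphs oriented by an interval order

-- For G = Inc P this is satisfied by the strict order of P and by its converse,
-- which is how the upward construction also covers the downward case.
record IsIntervalOrientation (G : Graph c ℓ₁ ℓ₂) (_<_ : Rel (Graph.V G) ℓ₃)
       : Set (c ⊔ ℓ₁ ⊔ ℓ₂ ⊔ ℓ₃) where
  open Graph G
  field
    isDecStrictPartialOrder : IsDecStrictPartialOrder _≈_ _<_
    ~⇒≮                     : ∀ {x y} → x ~ y → ¬ (x < y)
    ≮∧≯∧≉⇒~                 : ∀ {x y} → ¬ (x < y) → ¬ (y < x) → ¬ (x ≈ y) → x ~ y
    2+2-free                : ∀ {x y u v} → x < y → u < v → x < v ⊎ u < y

  open IsDecStrictPartialOrder isDecStrictPartialOrder public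
    using (isStrictPartialOrder; _<?_; _≟_; <-respʳ-≈; <-respˡ-≈)
    renaming (asym to <-asym; trans to <-trans; irrefl to <-irrefl)

  data Position (x y : V) : Set (ℓ₁ ⊔ ℓ₂ ⊔ ℓ₃) where
    below    : x < y → Position x y
    above    : y < x → Position x y
    equal    : x ≈ y → Position x y
    adjacent : x ~ y → Position x y

  position : ∀ x y → Position x y
  position x y with x <? y | y <? x | x ≟ y
  ... | yes x<y | _       | _       = below x<y
  ... | no  _   | yes y<x | _       = above y<x
  ... | no  _   | no  _   | yes x≈y = equal x≈y
  ... | no  x≮y | no  x≯y | no  x≉y = adjacent (≮∧≯∧≉⇒~ x≮y x≯y x≉y)

flip-orientation : {G : Graph c ℓ₁ ℓ₂} {_<_ : Rel (Graph.V G) ℓ₃} →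
                   IsIntervalOrientation G _<_ → IsIntervalOrientation G (flip _<_)
flip-orientation {G = G} O = record
  { isDecStrictPartialOrder = record
    { isStrictPartialOrder = Flip.isStrictPartialOrder isStrictPartialOrder
    ; _≟_                  = _≟_
    ; _<?_                 = flip _<?_
    }
  ; ~⇒≮      = ~⇒≮ ∘ Graph.~-sym G
  ; ≮∧≯∧≉⇒~  = flip ≮∧≯∧≉⇒~
  ; 2+2-free = λ y<x v<u → swap (2+2-free y<x v<u)
  }
  where open IsIntervalOrientation O

-- Distance to a base vertex

module Distance (G : Graph c ℓ₁ ℓ₂) (em : ExcludedMiddle (c ⊔ ℓ₁ ⊔ ℓ₂))
                (connected : Connected G) (o : Graph.V G) where
  open Graph G
  open Setoid vertices using () renaming (refl to ≈-refl; sym to ≈-sym; trans to ≈-trans)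

  private
    shortest : ∀ x → ∃[ n ] Walk G x o n × IsShortest {G = G} x o n
    shortest x = let n , w , _ = connected x o in least em (n , w)

  dist : V → ℕ
  dist x = proj₁ (shortest x)

  geodesic : ∀ x → Walk G x o (dist x)
  geodesic x = proj₁ (proj₂ (shortest x))

  dist-least : ∀ {x n} → Walk G x o n → dist x ≤ n
  dist-least {x} = proj₂ (proj₂ (shortest x))

  dist-walk : ∀ {x y n} → Walk G x y n → dist x ≤ n + dist y
  dist-walk {y = y} w = dist-least (w ++ geodesic y)

  dist-~ : ∀ {x y} → x ~ y → dist x ≤ suc (dist y)
  dist-~ {y = y} e = dist-least (cons e (geodesic y))

  dist-≈ : ∀ {x y} → x ≈ y → dist x ≡ dist y
  dist-≈ x≈y = ≤-antisym (dist-walk (nil x≈y)) (dist-walk (nil (≈-sym x≈y)))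

  dist≡0⇒≈ : ∀ {x} → dist x ≡ 0 → x ≈ o
  dist≡0⇒≈ {x} eq with subst (Walk G x o) eq (geodesic x)
  ... | nil x≈o = x≈o

  closer : ∀ {x n} → dist x ≡ suc n → ∃[ u ] x ~ u × dist u ≡ n
  closer {x} eq with subst (Walk G x o) eq (geodesic x)
  ... | cons {y = u} x~u w =
    u , x~u , ≤-antisym (dist-least w) (s≤s⁻¹ (subst (_≤ suc (dist u)) eq (dist-~ x~u)))

  -- `dist` changes along a walk by at most its length, so no walk from `p i` to `p j` is shorter
  -- than `∣ i - j ∣`; the stretch of `p` between them attains this.
  levelled⇒isometric : (p : ℕ → V) → (∀ n → dist (p n) ≡ n) → (∀ n → p n ~ p (suc n)) →
                       IsInfiniteIsometricPath G p
  levelled⇒isometric p dp e i j =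
    shortest⇒distance (along p e i j) λ w → ∣m-n∣≤o i j (bound i j w) (bound j i (reverse w))
    where
    bound : ∀ i j {m} → Walk G (p i) (p j) m → i ≤ m + j
    bound i j {m} w = ≡.subst₂ (λ a b → a ≤ m + b) (dp i) (dp j) (dist-walk w)

  -- Levels not below the base vertex

  module Ascent
    {_<_ : Rel V (ℓ₁ ⊔ ℓ₂)} (O : IsIntervalOrientation G _<_)
    (finite : {A : Pred V (c ⊔ ℓ₁ ⊔ ℓ₂)} →
              (∀ {x y} → x ∈ A → y ∈ A → ¬ (x ≈ y) → x ~ y) →
              Σ[ xs ∈ List V ] A ⊆ (λ x → Membership._∈_ vertices x xs))
    (unbounded : ∀ n → ∃[ y ] ¬ (y < o) × n ≤ dist y)
    where

    open IsIntervalOrientation O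

    AtLevel : ℕ → Pred V (ℓ₁ ⊔ ℓ₂)
    AtLevel n y = ¬ (y < o) × dist y ≡ n

    -- Follow the walk while it stays above `z`. It cannot reach `o` that way, nor can it jump below
    -- `z`, since `v < z < u` contradicts `u ~ v`. So it leaves through a vertex equal or adjacent
    -- to `z`.
    dist-mono : ∀ {z u n} → Walk G u o n → z < u → ¬ (z < o) → dist z ≤ n
    dist-mono (nil u≈o) z<u z≮o = contradiction (<-respʳ-≈ u≈o z<u) z≮o
    dist-mono {z} (cons {y = v} u~v w) z<u z≮o with position z v
    ... | below z<v    = m≤n⇒m≤1+n (dist-mono w z<v z≮o)
    ... | above v<z    = contradiction (<-trans v<z z<u) (~⇒≮ (~-sym u~v))
    ... | equal z≈v    = m≤n⇒m≤1+n (dist-least (walk-respˡ (≈-sym z≈v) w))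
    ... | adjacent z~v = dist-least (cons z~v w)

    farther⇒≮ : ∀ {n u z} → dist u ≡ n → z ∈ AtLevel (suc n) → ¬ (z < u)
    farther⇒≮ {u = u} refl (z≮o , dz) z<u =
      1+n≰n (subst (_≤ _) dz (dist-mono (geodesic u) z<u z≮o))

    farther⇒< : ∀ {n u z} → dist u ≡ n → z ∈ AtLevel (2 + n) → u < z
    farther⇒< {u = u} {z} refl (z≮o , dz) with position u z
    ... | below u<z    = u<z
    ... | above z<u    = contradiction (dist-mono (geodesic u) z<u z≮o)
                           (λ le → 1+n≰n (≤-trans (n≤1+n _) (subst (_≤ _) dz le)))
    ... | equal u≈z    = contradiction (≡.trans (dist-≈ u≈z) dz) (<⇒≢ (n≤1+n _))
    ... | adjacent u~z = contradiction (subst (_≤ _) dz (dist-~ (~-sym u~z))) 1+n≰n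

    -- The next vertex `u` of a geodesic serves. Were it below `o`, its neighbour `y` would have to
    -- be adjacent to `o`; then `y` has distance 1 and `u` is `o` itself.
    descend : ∀ {n y} → y ∈ AtLevel (suc n) → ∃[ u ] y ~ u × u ∈ AtLevel n
    descend {n} {y} (y≮o , dy) with closer dy
    ... | u , y~u , du = u , y~u , u≮o , du
      where
      u≮o : ¬ (u < o)
      u≮o u<o with position o y
      ... | below o<y = ~⇒≮ (~-sym y~u) (<-trans u<o o<y)
      ... | above y<o = y≮o y<o
      ... | equal o≈y = ~⇒≮ (~-sym y~u) (<-respʳ-≈ o≈y u<o)
      ... | adjacent o~y with dist≡0⇒≈ du′
        where
        du′ : dist u ≡ 0
        du′ = ≡.trans du (n≤0⇒n≡0 (s≤s⁻¹
                (subst (_≤ 1) dy (dist-least (cons (~-sym o~y) (nil ≈-refl))))))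
      ...   | u≈o = <-irrefl u≈o u<o

    level-inhabited : ∀ n → ∃ (AtLevel n)
    level-inhabited n =
      let y , y≮o , n≤d = unbounded n in go (≤⇒≤′ n≤d) (y≮o , refl)
      where
      go : ∀ {m y} → n ℕ.≤′ m → y ∈ AtLevel m → ∃ (AtLevel n)
      go ℕ.≤′-refl       y∈ = _ , y∈
      go (ℕ.≤′-step n≤m) y∈ = let u , _ , u∈ = descend y∈ in go n≤m u∈

    Extendible : ℕ → Pred V (c ⊔ ℓ₁ ⊔ ℓ₂)
    Extendible n y = y ∈ AtLevel n × ∃[ z ] y ~ z × z ∈ AtLevel (suc n)

    extendible-≮ : ∀ {n x y} → x ∈ Extendible n → y ∈ Extendible n → ¬ (x < y)
    -- There is no lower level to use here, but every vertex at distance 0 equals `o`.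
    extendible-≮ {zero} ((_ , dx) , _) ((y≮o , dy) , _) x<y =
      <-irrefl (≈-trans (dist≡0⇒≈ dx) (≈-sym (dist≡0⇒≈ dy))) x<y
    -- `u` may lie below `o`: `farther⇒<` asks only for its distance.
    extendible-≮ {suc n} (_ , z , x~z , z∈) ((_ , dy) , _) x<y with closer dy
    ... | u , y~u , du with 2+2-free x<y (farther⇒< du z∈)
    ...   | inj₁ x<z = ~⇒≮ x~z x<z
    ...   | inj₂ u<y = ~⇒≮ (~-sym y~u) u<y

    -- Reverse inclusion of strict up-sets, so a greatest element has the least up-set. `2+2-free`
    -- makes them nested: if `z` is above `y` but not above `x`, then every `w` above `x` is above
    -- `y`.
    upSetPreorder : TotalPreorder c ℓ₁ (c ⊔ ℓ₁ ⊔ ℓ₂)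
    upSetPreorder = record
      { Carrier = V
      ; _≈_ = _≈_
      ; _≲_ = λ x y → ∀ {z} → y < z → x < z
      ; isTotalPreorder = record
        { isPreorder = record
          { isEquivalence = Setoid.isEquivalence vertices
          ; reflexive = λ x≈y → <-respˡ-≈ (≈-sym x≈y)
          ; trans = λ x≲y y≲z z<w → x≲y (y≲z z<w)
          }
        ; total = total
        }
      }
      where
      total : ∀ x y → (∀ {z} → y < z → x < z) ⊎ (∀ {z} → x < z → y < z)
      total x y with em {∃[ z ] y < z × ¬ (x < z)}
      ... | yes (z , y<z , x≮z) =
        inj₂ λ x<w → fromInj₂ (λ x<z → contradiction x<z x≮z) (2+2-free x<w y<z)
      ... | no ∄z = inj₁ λ {z} y<z → decidable-stable (x <? z) λ x≮z → ∄z (z , y<z , x≮z)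

    hub : ∀ n → ∃[ y ] y ∈ AtLevel n × (∀ {z} → z ∈ AtLevel (suc n) → y ~ z)
    hub n = y , y∈ , meets
      where
      covered : Σ[ xs ∈ List V ] Extendible n ⊆ (λ x → Membership._∈_ vertices x xs)
      covered = finite {Extendible n} λ x∈ y∈ →
        ≮∧≯∧≉⇒~ (extendible-≮ x∈ y∈) (extendible-≮ y∈ x∈)

      inhabited : ∃ (Extendible n)
      inhabited = let z , z∈ = level-inhabited (suc n)
                      u , z~u , u∈ = descend z∈
                  in u , u∈ , z , ~-sym z~u , z∈

      best : ∃[ y ] y ∈ Extendible n ×
               (∀ {u} → u ∈ Extendible n → Membership._∈_ vertices u (proj₁ covered) →
                ∀ {z} → y < z → u < z)
      best = greatest upSetPreorder em inhabited (proj₁ covered)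

      y : V
      y = proj₁ best

      y∈ : y ∈ AtLevel n
      y∈ = proj₁ (proj₁ (proj₂ best))

      meets : ∀ {z} → z ∈ AtLevel (suc n) → y ~ z
      meets {z} z∈ with position y z
      -- `z` has an extendible neighbour `u`; as the up-set of `y` is least, `z` would lie above `u`
      -- too.
      ... | below y<z =
        let u , z~u , u∈ = descend z∈
            u∈′ = u∈ , z , ~-sym z~u , z∈
        in contradiction (proj₂ (proj₂ best) u∈′ (proj₂ covered u∈′) y<z) (~⇒≮ (~-sym z~u))
      ... | above z<y = contradiction z<y (farther⇒≮ (proj₂ y∈) z∈)
      ... | equal y≈z = contradiction
                          (≡.trans (≡.sym (proj₂ y∈)) (≡.trans (dist-≈ y≈z) (proj₂ z∈)))
                          (<⇒≢ (n<1+n n))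
      ... | adjacent y~z = y~z

    isometricPath : HasInfiniteIsometricPath G
    isometricPath =
      proj₁ ∘ hub ,
      levelled⇒isometric (proj₁ ∘ hub) (λ n → proj₂ (proj₁ (proj₂ (hub n))))
        (λ n → proj₂ (proj₂ (hub n)) (proj₁ (proj₂ (hub (suc n)))))

-- From infinite diameter to unbounded distance

longDistance : {G : Graph c ℓ₁ ℓ₂} → ExcludedMiddle (c ⊔ ℓ₁ ⊔ ℓ₂) →
               Connected G → HasInfiniteDiameter G →
               ∀ n → ∃₂ λ x y → ∃[ m ] IsDistance G x y [ m ] × n ℕ.< m
longDistance {G = G} em connected (_ , ≤bound) n =
  -- Otherwise `[ n ]` bounds all distances, and the supremum `⊤⁺` would be at most `[ n ]`.
  decidable-stable em λ ∄ → case ≤bound {[ n ]} (bounded ∄) of λ ()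
  where
  bounded : ¬ (∃₂ λ x y → ∃[ m ] IsDistance G x y [ m ] × n ℕ.< m) →
            ∀ {d} → (∃₂ λ x y → IsDistance G x y d) → d ≤⁺ [ n ]
  bounded ∄ {[ m ]} (x , y , d) = [ ≮⇒≥ (λ n<m → ∄ (x , y , m , d , n<m)) ]
  bounded ∄ {⊤⁺}    (x , y , d) = contradiction (proj₂ (connected x y)) d

-- By the triangle inequality through `o`, two vertices more than `n + n` apart cannot both be
-- within `n` of `o`.
longDistanceFrom : {G : Graph c ℓ₁ ℓ₂} (em : ExcludedMiddle (c ⊔ ℓ₁ ⊔ ℓ₂))
                   (connected : Connected G) → HasInfiniteDiameter G →
                   ∀ o n → ∃[ y ] n ≤ Distance.dist G em connected o y
longDistanceFrom {G = G} em connected infinite o n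
  with longDistance em connected infinite (n + n)
... | x , y , m , (_ , m-least) , n+n<m = split (≤-total n (dist x)) (≤-total n (dist y))
  where
  open Distance G em connected o

  m≤ : m ≤ dist x + dist y
  -- The walk through `o` may repeat vertices while `m-least` concerns paths; a shortest walk is a
  -- path.
  m≤ with least em (_ , geodesic x ++ reverse (geodesic y))
  ... | k , w , k-least =
    ≤-trans (m-least (w , shortest⇒unique w k-least)) (k-least (geodesic x ++ reverse (geodesic y)))

  split : n ≤ dist x ⊎ dist x ≤ n → n ≤ dist y ⊎ dist y ≤ n → ∃[ z ] n ≤ dist z
  split (inj₁ n≤) _ = x , n≤
  split _ (inj₁ n≤) = y , n≤
  split (inj₂ x≤n) (inj₂ y≤n) =
    contradiction (≤-trans n+n<m (≤-trans m≤ (+-mono-≤ x≤n y≤n))) 1+n≰n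

-- Interval orders contain no 2 + 2

module _ {P : Poset c ℓ₁ ℓ₂} where
  open Poset P using (_≈_; module Eq) renaming (_≤_ to _⊑_)
  open PosetProperties P
    using (_<_; <-trans; <-respʳ-≈; ≤-dec⇒isDecPartialOrder)

  -- If both comparisons failed, endpoints chosen in the four intervals would form a cycle in the
  -- chain. The disjunction is put negatively because no comparison in `P` is decided here.
  intervalOrder⇒2+2-free : IsIntervalOrder r P →
    ∀ {x y u v} → x < y → u < v → ¬ (x < v) → ¬ ¬ (u < y)
  intervalOrder⇒2+2-free (C , S , f , iso) {x} {y} {u} {v} x<y u<v x≮v u≮y =
    x⋢v (cancel (inj₁ Ix<Iv))
    where
    module C = TotalOrder C
    open IsOrderIsomorphism iso using (mono; cancel; injective)
    open ToStrict C._≈_ C._≤_ using () renaming (_<_ to _<′_)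

    I : Poset.Carrier P → Interval C
    I = proj₁ ∘ f

    strict : ∀ {a b} → a < b → _<ᴵ_ C (I a) (I b)
    strict (a⊑b , a≉b) with mono a⊑b
    ... | inj₁ Ia<Ib = Ia<Ib
    ... | inj₂ Ia≈Ib = contradiction (injective Ia≈Ib) a≉b

    ≰⇒> : ∀ {a b} → ¬ (a C.≤ b) → b <′ a
    ≰⇒> = ToStrict.≰⇒> C._≈_ C._≤_ C.Eq.sym C.reflexive C.total

    -- `cancel` reflects only the non-strict order, so equality must be excluded: `x ≈ v` would give
    -- `u < x < y`.
    x⋢v : ¬ (x ⊑ v)
    x⋢v x⊑v = x≮v (x⊑v , λ x≈v → u≮y (<-trans (<-respʳ-≈ (Eq.sym x≈v) u<v) x<y))

    u⋢y : ¬ (u ⊑ y)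
    u⋢y u⊑y = u≮y (u⊑y , λ u≈y → x≮v (<-trans (<-respʳ-≈ (Eq.sym u≈y) x<y) u<v))

    -- If b ≤ e and d ≤ a, then a < b ≤ e < d ≤ a.
    Ix<Iv : _<ᴵ_ C (I x) (I v)
    Ix<Iv a∈x d∈v = ≰⇒> λ d≤a → u⋢y (cancel (inj₁ λ e∈u b∈y → ≰⇒> λ b≤e →
      let a≤b , a≉b = strict x<y a∈x b∈y
          e≤d , _   = strict u<v e∈u d∈v
      in a≉b (C.antisym a≤b (C.trans b≤e (C.trans e≤d d≤a)))))

  intervalOrientation : Decidable _⊑_ → IsIntervalOrder r P → IsIntervalOrientation (Inc P) _<_
  intervalOrientation _⊑?_ interval = record
    { isDecStrictPartialOrder = isDecStrictPartialOrder
    ; ~⇒≮      = λ (x⋢y , _) (x⊑y , _) → x⋢y x⊑y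
    ; ≮∧≯∧≉⇒~  = λ x≮y x≯y x≉y →
        (λ x⊑y → x≮y (x⊑y , x≉y)) , (λ y⊑x → x≯y (y⊑x , x≉y ∘ Eq.sym))
    ; 2+2-free = 2+2-free
    }
    where
    isDecStrictPartialOrder : IsDecStrictPartialOrder _≈_ _<_
    isDecStrictPartialOrder =
      ToStrict.<-isDecStrictPartialOrder _≈_ _⊑_ (≤-dec⇒isDecPartialOrder _⊑?_)

    open IsDecStrictPartialOrder isDecStrictPartialOrder using (_<?_)

    2+2-free : ∀ {x y u v} → x < y → u < v → x < v ⊎ u < y
    2+2-free {x} {y} {u} {v} x<y u<v with x <? v
    ... | yes x<v = inj₁ x<v
    ... | no  x≮v = inj₂ (decidable-stable (u <? y)
                      (intervalOrder⇒2+2-free interval x<y u<v x≮v))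

-- Choice of direction

theorem6 : ∀ {c ℓ₁ ℓ₂ r : Level} →
    ExcludedMiddle (c ⊔ ℓ₁ ⊔ ℓ₂) →
    (P : Poset c ℓ₁ ℓ₂) →
    IsIntervalOrder r P →
    NoInfiniteAntichain P →
    Connected (Inc P) →
    HasInfiniteDiameter (Inc P) →
    HasInfiniteIsometricPath (Inc P)
theorem6 {c} {ℓ₁} {ℓ₂} em P interval noInfinite connected infinite =
  case em {∀ n → ∃[ y ] ¬ (y < o) × n ≤ dist y} of λ where
    (yes up) → Ascent.isometricPath O finite up
    (no ¬up) → Ascent.isometricPath (flip-orientation O) finite λ n →
      decidable-stable em λ ∄down → ¬up λ m →
        decidable-stable em λ ∄up →
          -- Suppose upward distances stay below `m` and downward ones below `n`. A vertex at
          -- distance `m + n` or more is then above `o` by the choice of `n`, hence not below `o`,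
          -- against the choice of `m`.
          let y , m+n≤dy = longDistanceFrom em connected infinite o (m + n)
              o<y = decidable-stable (o <? y) λ o≮y →
                ∄down (y , o≮y , m+n≤o⇒n≤o m m+n≤dy)
          in ∄up (y , <-asym o<y , m+n≤o⇒m≤o m m+n≤dy)
  where
  O : IsIntervalOrientation (Inc P) (PosetProperties._<_ P)
  O = intervalOrientation {P = P} (λ _ _ → lowerEM ℓ₂ (c ⊔ ℓ₁) em) interval

  open PosetProperties P using (_<_)
  open IsIntervalOrientation O using (_<?_; <-asym)

  o : Poset.Carrier P
  -- Any vertex can serve as base; the infinite diameter supplies one.
  o = proj₁ (longDistance em connected infinite 0)

  open Distance (Inc P) em connected o

  finite : {A : Pred (Poset.Carrier P) (c ⊔ ℓ₁ ⊔ ℓ₂)} → IsAntichain P A → IsFinite P A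
  finite {A} antichain = decidable-stable em λ infinite → noInfinite (A , antichain , infinite)
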